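{- For every integer $n\ge 1$, the number of one-ball siteswap sequences of length $n$ is $2^n-1$, and the number of one-ball spherical siteswap sequences of length $n$ is also $2^n-1$.
   Context: A siteswap sequence of length (period) $n$ is a sequence $t_1t_2\ldots t_n$ of nonnegative integers such that the residues $i+t_i \pmod n$, $1\le i\le n$, are pairwise distinct, i.e. $\{1,\ldots,n\}=\bigcup_{i=1}^n\{i+t_i \pmod n\}$. Its number of balls is the integer $(t_1+\cdots+t_n)/n$; thus a one-ball siteswap sequence has $t_1+\cdots+t_n=n$. A spherical siteswap sequence of length $n$ is a siteswap sequence $t_1t_2\ldots t_n$ for which, in addition, the values $i+(t_i/2) \pmod n$ (rational numbers taken modulo $n$), over those $i$ with $t_i\ne 0$, are pairwise distinct. Rotations of a sequence are considered distinct, and sequences of length $n$ are counted whether or not $n$ is their minimal period. -}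

module Defs where

open import Data.Nat.Base as ℕ using (ℕ; suc; NonZero)
open import Data.Nat.DivMod using (_%_)
open import Data.Integer.Base using (ℤ; +_)
open import Data.Rational.Base as ℚ using (ℚ; 1ℚ)
open import Data.Fin.Base using (Fin; toℕ)
open import Data.Vec.Base using (Vec; lookup; sum)
open import Data.List.Base using (List; length)
open import Data.List.Membership.Propositional using (_∈_)
open import Data.List.Relation.Unary.Unique.Propositional using (Unique)
open import Data.Product.Base using (Σ-syntax; ∃-syntax; _×_)
open import Function.Bundles using (_⇔_)
open import Function.Definitions using (Injective)
open import Relation.Binary.PropositionalEquality.Core using (_≡_; _≢_)

-- Time positions are numbered 1, …, n, whereas Fin n starts at 0.
position : ∀ {n} → Fin n → ℕ
position i = suc (toℕ i)

module _ {n : ℕ} .{{_ : NonZero n}} where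

  landing : Vec ℕ n → Fin n → ℕ
  landing t i = (position i ℕ.+ lookup t i) % n

  IsSiteswap : Vec ℕ n → Set
  IsSiteswap t = Injective _≡_ _≡_ (landing t)

  -- Rational-valued, so that being a b-ball sequence does not hide a
  -- rounding; it is an integer for siteswap sequences.
  balls : Vec ℕ n → ℚ
  balls t = + sum t ℚ./ n

  OneBall : Vec ℕ n → Set
  OneBall t = balls t ≡ 1ℚ

infix 4 _≡_[mod_]

_≡_[mod_] : ℚ → ℚ → ℕ → Set
p ≡ q [mod n ] = Σ[ k ∈ ℤ ] p ℚ.- q ≡ (k ℚ./ 1) ℚ.* (+ n ℚ./ 1)

midpoint : ∀ {n} → Vec ℕ n → Fin n → ℚ
midpoint t i = (+ position i ℚ./ 1) ℚ.+ (+ lookup t i ℚ./ 2)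

DistinctMidpoints : ∀ {n} → Vec ℕ n → Set
DistinctMidpoints {n} t =
  ∀ {i j} → lookup t i ≢ 0 → lookup t j ≢ 0 →
  midpoint t i ≡ midpoint t j [mod n ] → i ≡ j

IsSphericalSiteswap : ∀ {n} .{{_ : NonZero n}} → Vec ℕ n → Set
IsSphericalSiteswap t = IsSiteswap t × DistinctMidpoints t

-- Exactly k elements of A satisfy P.  Elements are counted up to _≡_ in A,
-- independently of how many proofs of P each of them has.
HasCount : {A : Set} → (A → Set) → ℕ → Set
HasCount {A} P k =
  ∃[ xs ] Unique xs × (∀ (x : A) → x ∈ xs ⇔ P x) × length xs ≡ k

{-# OPTIONS --safe #-}

-- A one-ball siteswap sequence t is determined by its support, the set of
-- positions i with t_i ≠ 0.  Since landing times are distinct and a position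
-- with t_j = 0 lands on itself, every nonzero throw lands in the support, so
-- t_i is at least the cyclic gap from i to the next support position.  Those
-- gaps add up to n, as do the t_i, so t_i is exactly the gap.  Conversely the
-- gap sequence of a nonempty subset is a one-ball siteswap, and it is spherical
-- because the midpoints lie inside the disjoint gaps.  Hence both kinds of
-- sequences correspond to the 2^n − 1 nonempty subsets.
module Submission where

open import Data.Bool.Base using (Bool; true; false; if_then_else_)
open import Data.Bool.Properties using (¬-not)
open import Data.Fin.Base using (Fin; zero; suc; toℕ)
open import Data.Fin.Properties using (toℕ-injective; toℕ<n; toℕ-fromℕ<)
open import Data.Integer.Base as ℤ using (-[1+_])
import Data.Integer.Properties as ℤ
import Data.Integer.Tactic.RingSolver as ℤSolver
open import Data.List.Base as List using (List; []; _∷_; _++_; length)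
open import Data.List.Membership.Propositional using (_∈_)
open import Data.List.Membership.Propositional.Properties
  using (∈-map⁺; ∈-map⁻; ∈-++⁺ˡ; ∈-++⁺ʳ; ∈-++⁻)
open import Data.List.Properties using (length-map; length-++)
open import Data.List.Relation.Binary.Disjoint.Propositional using (Disjoint)
import Data.List.Relation.Unary.All as All
open import Data.List.Relation.Unary.AllPairs using ([]; _∷_)
open import Data.List.Relation.Unary.Any using (here; there)
open import Data.List.Relation.Unary.Unique.Propositional using (Unique)
import Data.List.Relation.Unary.Unique.Propositional.Properties as Unique
open import Data.Nat.Base
open import Data.Nat.DivMod
open import Data.Nat.Properties
import Data.Nat.Tactic.RingSolver as ℕSolver
open import Data.Product.Base using (_×_; _,_; proj₁; proj₂; ∃-syntax)
open import Data.Rational.Base as ℚ using (toℚᵘ; 1ℚ)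
import Data.Rational.Properties as ℚ
open import Data.Rational.Unnormalised.Base as ℚᵘ using (mkℚᵘ; *≡*; _≃_)
import Data.Rational.Unnormalised.Properties as ℚᵘ
open import Data.Sum.Base using (_⊎_; inj₁; inj₂)
open import Data.Vec.Base as Vec using (Vec; []; _∷_; lookup; tabulate; replicate; sum)
open import Data.Vec.Properties using (lookup∘tabulate; lookup-map; tabulate∘lookup; tabulate-cong; ∷-injectiveʳ)
open import Function.Base using (_∘_; case_of_)
open import Function.Bundles using (mk⇔)
open import Relation.Binary.Definitions using (tri<; tri≈; tri>)
open import Relation.Binary.PropositionalEquality
open import Relation.Nullary using (¬_; contradiction)
open import Defs

-- Nonempty subsets

nonemptySubsets : ∀ n → List (Vec Bool n)
nonemptySubsets zero    = []
nonemptySubsets (suc n) =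
  List.map (true ∷_) (replicate n false ∷ nonemptySubsets n)
    ++ List.map (false ∷_) (nonemptySubsets n)

nonemptySubsets-inhabited : ∀ {n} {p : Vec Bool n} → p ∈ nonemptySubsets n →
                            ∃[ i ] lookup p i ≡ true
nonemptySubsets-inhabited {suc n} {p} p∈
  with ∈-++⁻ (List.map (true ∷_) (replicate n false ∷ nonemptySubsets n)) p∈
... | inj₁ p∈ˡ with _ , _ , refl ← ∈-map⁻ (true ∷_) p∈ˡ = zero , refl
... | inj₂ p∈ʳ with _ , q∈ , refl ← ∈-map⁻ (false ∷_) p∈ʳ
               with i , eq ← nonemptySubsets-inhabited q∈ = suc i , eq

∈-nonemptySubsets : ∀ {n} (p : Vec Bool n) →
                    p ≡ replicate n false ⊎ p ∈ nonemptySubsets n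
∈-nonemptySubsets [] = inj₁ refl
∈-nonemptySubsets (b ∷ p) with b | ∈-nonemptySubsets p
... | true  | inj₁ refl = inj₂ (here refl)
... | true  | inj₂ p∈   = inj₂ (∈-++⁺ˡ (∈-map⁺ (true ∷_) (there p∈)))
... | false | inj₁ refl = inj₁ refl
... | false | inj₂ p∈   = inj₂ (∈-++⁺ʳ _ (∈-map⁺ (false ∷_) p∈))

nonemptySubsets-unique : ∀ n → Unique (nonemptySubsets n)
nonemptySubsets-unique zero    = []
nonemptySubsets-unique (suc n) =
  Unique.++⁺ (Unique.map⁺ ∷-injectiveʳ (All.tabulate ∅≢ ∷ nonemptySubsets-unique n))
             (Unique.map⁺ ∷-injectiveʳ (nonemptySubsets-unique n))
             disjoint
  where
  lookup-∅ : ∀ {m} (i : Fin m) → lookup (replicate m false) i ≢ true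
  lookup-∅ (suc i) = lookup-∅ i

  ∅≢ : ∀ {p} → p ∈ nonemptySubsets n → replicate n false ≢ p
  ∅≢ p∈ refl with i , eq ← nonemptySubsets-inhabited p∈ = lookup-∅ i eq

  disjoint : Disjoint (List.map (true ∷_) (replicate n false ∷ nonemptySubsets n))
                      (List.map (false ∷_) (nonemptySubsets n))
  disjoint (p∈ , q∈)
    with _ , _ , refl ← ∈-map⁻ (true ∷_) p∈
    with _ , _ , () ← ∈-map⁻ (false ∷_) q∈

-- The successor keeps truncated subtraction out of the induction.
1+length-nonemptySubsets : ∀ n → suc (length (nonemptySubsets n)) ≡ 2 ^ n
1+length-nonemptySubsets zero    = refl
1+length-nonemptySubsets (suc n) = begin
  suc (length (List.map (true ∷_) (replicate n false ∷ L) ++ List.map (false ∷_) L))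
    ≡⟨ cong suc (length-++ (List.map (true ∷_) (replicate n false ∷ L))) ⟩
  suc (suc (length (List.map (true ∷_) L)) + length (List.map (false ∷_) L))
    ≡⟨ cong₂ (λ x y → suc (suc x + y)) (length-map (true ∷_) L) (length-map (false ∷_) L) ⟩
  suc (suc (length L) + length L)  ≡⟨ +-suc (suc (length L)) (length L) ⟨
  suc (length L) + suc (length L)  ≡⟨ cong₂ _+_ ih (trans ih (sym (+-identityʳ (2 ^ n)))) ⟩
  2 ^ suc n                        ∎
  where
  open ≡-Reasoning
  L = nonemptySubsets n
  ih = 1+length-nonemptySubsets n

-- Sums of vectors

sum-mono-≤ : ∀ {n} (u v : Vec ℕ n) → (∀ i → lookup u i ≤ lookup v i) → sum u ≤ sum v
sum-mono-≤ []      []      _   = z≤n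
sum-mono-≤ (x ∷ u) (y ∷ v) u≤v = +-mono-≤ (u≤v zero) (sum-mono-≤ u v (u≤v ∘ suc))

-- A single strict inequality between entries would already separate the sums. This upgrades the
-- entrywise lower bound by gaps to an equality.
≤∧sum≡⇒≡ : ∀ {n} (u v : Vec ℕ n) → (∀ i → lookup u i ≤ lookup v i) → sum u ≡ sum v → u ≡ v
≤∧sum≡⇒≡ []      []      _   _  = refl
≤∧sum≡⇒≡ (x ∷ u) (y ∷ v) u≤v eq with m≤n⇒m<n∨m≡n (u≤v zero)
... | inj₁ x<y  =
  contradiction eq (<⇒≢ (+-mono-<-≤ x<y (sum-mono-≤ u v (u≤v ∘ suc))))
... | inj₂ refl =
  cong (x ∷_) (≤∧sum≡⇒≡ u v (u≤v ∘ suc) (+-cancelˡ-≡ x (sum u) (sum v) eq))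

-- The hypothesis says `f k = 1 + d (suc k) - d k` without subtraction. Summing leaves only the
-- boundary terms `d 0` and `d m`, which cancel when `d` has period `m`.
sum-telescope : ∀ (f d : ℕ → ℕ) → (∀ k → f k + d k ≡ suc (d (suc k))) →
                ∀ m → sum (tabulate {n = m} (f ∘ toℕ)) + d 0 ≡ m + d m
sum-telescope f d step zero    = refl
sum-telescope f d step (suc m) = begin
  f 0 + rest + d 0    ≡⟨ cong (_+ d 0) (+-comm (f 0) rest) ⟩
  rest + f 0 + d 0    ≡⟨ +-assoc rest (f 0) (d 0) ⟩
  rest + (f 0 + d 0)  ≡⟨ cong (rest +_) (step 0) ⟩
  rest + suc (d 1)    ≡⟨ +-suc rest (d 1) ⟩
  suc (rest + d 1)    ≡⟨ cong suc (sum-telescope (f ∘ suc) (d ∘ suc) (step ∘ suc) m) ⟩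
  suc m + d (suc m)   ∎
  where
  open ≡-Reasoning
  rest = sum (tabulate {n = m} (f ∘ suc ∘ toℕ))

-- First occurrence of true in a stream

IsFirst : (ℕ → Bool) → ℕ → Set
IsFirst S g = S g ≡ true × (∀ {h} → h < g → S h ≡ false)

-- The smaller of two different candidates would be a hit where the larger one forbids any.
-- Distances can thus be compared without unfolding the search.
IsFirst-unique : ∀ {S g h} → IsFirst S g → IsFirst S h → g ≡ h
IsFirst-unique {S} {g} {h} (Sg , <g) (Sh , <h) with <-cmp g h
... | tri< g<h _ _ = case trans (sym Sg) (<h g<h) of λ ()
... | tri≈ _ g≡h _ = g≡h
... | tri> _ _ h<g = case trans (sym Sh) (<g h<g) of λ ()

IsFirst-suc : ∀ {S g} → S 0 ≡ false → IsFirst (S ∘ suc) g → IsFirst S (suc g)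
IsFirst-suc S0 (Sg , <g) = Sg , λ { {zero} _ → S0 ; {suc h} (s≤s h<g) → <g h<g }

IsFirst-cong : ∀ {S S′ g} → S ≗ S′ → IsFirst S g → IsFirst S′ g
IsFirst-cong S≗S′ (Sg , <g) =
  trans (sym (S≗S′ _)) Sg , λ h<g → trans (sym (S≗S′ _)) (<g h<g)

-- Only the arguments 0, …, fuel are searched; junk if none of them is true.
first : (fuel : ℕ) → (ℕ → Bool) → ℕ
first zero       S = 0
first (suc fuel) S = if S 0 then 0 else suc (first fuel (S ∘ suc))

first-cong : ∀ fuel {S S′} → S ≗ S′ → first fuel S ≡ first fuel S′
first-cong zero       S≗S′ = refl
first-cong (suc fuel) S≗S′
  rewrite S≗S′ 0 | first-cong fuel (S≗S′ ∘ suc) = refl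

-- Any hit `g` within reach of the fuel will do as a witness; the search may stop earlier.
first-isFirst : ∀ fuel {S g} → S g ≡ true → g ≤ fuel → IsFirst S (first fuel S)
first-isFirst zero       Sg z≤n = Sg , λ ()
first-isFirst (suc fuel) {S} {g} Sg g≤ with S 0 in S0 | g | g≤
... | true  | _     | _        = S0 , λ ()
... | false | zero  | _        = case trans (sym Sg) S0 of λ ()
... | false | suc _ | s≤s g≤′ = IsFirst-suc S0 (first-isFirst fuel Sg g≤′)

-- Cyclic sequences

module _ {n : ℕ} .{{_ : NonZero n}} where

  %-congˡ-+ : ∀ {k k′} l → k % n ≡ k′ % n → (k + l) % n ≡ (k′ + l) % n
  %-congˡ-+ {k} {k′} l eq = begin
    (k + l) % n              ≡⟨ %-distribˡ-+ k l n ⟩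
    (k % n + l % n) % n      ≡⟨ cong (λ r → (r + l % n) % n) eq ⟩
    (k′ % n + l % n) % n     ≡⟨ %-distribˡ-+ k′ l n ⟨
    (k′ + l) % n             ∎
    where open ≡-Reasoning

  -- Each side receives the other side's quotient, so the congruence becomes an equation in ℕ with
  -- no subtraction.
  %≡⇒+*≡ : ∀ x y → x % n ≡ y % n → ∃[ a ] ∃[ b ] x + a * n ≡ y + b * n
  %≡⇒+*≡ x y eq = y / n , x / n , (begin
    x + y / n * n                    ≡⟨ cong (_+ y / n * n) (m≡m%n+[m/n]*n x n) ⟩
    x % n + x / n * n + y / n * n    ≡⟨ cong (λ r → r + x / n * n + y / n * n) eq ⟩
    y % n + x / n * n + y / n * n    ≡⟨ swap (y % n) (x / n * n) (y / n * n) ⟩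
    y % n + y / n * n + x / n * n    ≡⟨ cong (_+ x / n * n) (m≡m%n+[m/n]*n y n) ⟨
    y + x / n * n                    ∎)
    where
    open ≡-Reasoning
    swap : ∀ a b c → a + b + c ≡ a + c + b
    swap = ℕSolver.solve-∀

  toℕ%n : (i : Fin n) → toℕ i % n ≡ toℕ i
  toℕ%n i = m<n⇒m%n≡m (toℕ<n i)

  toℕ-mod : ∀ k → toℕ (k mod n) ≡ k % n
  toℕ-mod k = toℕ-fromℕ< (m%n<n k n)

  toℕ+*-injective : ∀ {i j : Fin n} a b → toℕ i + a * n ≡ toℕ j + b * n → i ≡ j
  toℕ+*-injective {i} {j} a b eq = toℕ-injective (begin
    toℕ i                 ≡⟨ toℕ%n i ⟨
    toℕ i % n             ≡⟨ [m+kn]%n≡m%n (toℕ i) a n ⟨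
    (toℕ i + a * n) % n   ≡⟨ cong (_% n) eq ⟩
    (toℕ j + b * n) % n   ≡⟨ [m+kn]%n≡m%n (toℕ j) b n ⟩
    toℕ j % n             ≡⟨ toℕ%n j ⟩
    toℕ j                 ∎)
    where open ≡-Reasoning

  -- The vector becomes an `n`-periodic function on ℕ, so gaps that wrap past the end need no
  -- separate treatment.
  cyclic : ∀ {A : Set} → Vec A n → ℕ → A
  cyclic v k = lookup v (k mod n)

  cyclic-cong : ∀ {A : Set} (v : Vec A n) {k l} → k % n ≡ l % n → cyclic v k ≡ cyclic v l
  cyclic-cong v {k} {l} eq =
    cong (lookup v) (toℕ-injective (trans (toℕ-mod k) (trans eq (sym (toℕ-mod l)))))

  cyclic-toℕ : ∀ {A : Set} (v : Vec A n) i → cyclic v (toℕ i) ≡ lookup v i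
  cyclic-toℕ v i =
    cong (lookup v) (toℕ-injective (trans (toℕ-mod (toℕ i)) (toℕ%n i)))

  cyclic-+* : ∀ {A : Set} (v : Vec A n) k a → cyclic v (k + a * n) ≡ cyclic v k
  cyclic-+* v k a = cyclic-cong v ([m+kn]%n≡m%n k a n)

  -- Gap sequences

  module _ (p : Vec Bool n) where

    -- Junk if p is empty; otherwise n + n steps are more than enough.
    distance : ℕ → ℕ
    distance k = first (n + n) (λ l → cyclic p (k + l))

    -- The search starts at `suc k`, so the only member of a singleton meets itself again after a
    -- full turn and has gap `n`, not 0.
    gap : ℕ → ℕ
    gap k = if cyclic p k then suc (distance (suc k)) else 0

    gaps : Vec ℕ n
    gaps = tabulate (gap ∘ toℕ)

    distance-cong : ∀ {k k′} → k % n ≡ k′ % n → distance k ≡ distance k′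
    distance-cong eq = first-cong (n + n) (λ l → cyclic-cong p (%-congˡ-+ l eq))

    gap-+* : ∀ k a → gap (k + a * n) ≡ gap k
    gap-+* k a
      rewrite cyclic-+* p k a
            | distance-cong {suc (k + a * n)} {suc k} ([m+kn]%n≡m%n (suc k) a n) = refl

    lookup-gaps : ∀ i → lookup gaps i ≡ gap (toℕ i)
    lookup-gaps = lookup∘tabulate (gap ∘ toℕ)

    gap-true : ∀ {k} → cyclic p k ≡ true → gap k ≡ suc (distance (suc k))
    gap-true eq rewrite eq = refl

    gap-false : ∀ {k} → cyclic p k ≡ false → gap k ≡ 0
    gap-false eq rewrite eq = refl

    gaps≢0⇒true : ∀ i → lookup gaps i ≢ 0 → cyclic p (toℕ i) ≡ true
    gaps≢0⇒true i t≢0 = ¬-not (λ eq → t≢0 (trans (lookup-gaps i) (gap-false eq)))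

    module _ (inhabited : ∃[ i ] lookup p i ≡ true) where

      distance-isFirst : ∀ k → IsFirst (λ l → cyclic p (k + l)) (distance k)
      distance-isFirst k = first-isFirst (n + n) hit bound
        where
        i = proj₁ inhabited
        -- Go from `k` to the next multiple of `n`, then `toℕ i` further: this reaches the known
        -- member `i` in the following period, within the fuel `n + n`.
        g = (n ∸ k % n) + toℕ i

        bound : g ≤ n + n
        bound = +-mono-≤ (m∸n≤m n (k % n)) (<⇒≤ (toℕ<n i))

        k+g : k + g ≡ toℕ i + suc (k / n) * n
        k+g = begin
          k + g                                     ≡⟨ cong (_+ g) (m≡m%n+[m/n]*n k n) ⟩
          k % n + k / n * n + (n ∸ k % n + toℕ i)   ≡⟨ regroup (k % n) (k / n * n) (n ∸ k % n) (toℕ i) ⟩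
          toℕ i + (k % n + (n ∸ k % n) + k / n * n) ≡⟨ cong (λ m → toℕ i + (m + k / n * n)) (m+[n∸m]≡n (<⇒≤ (m%n<n k n))) ⟩
          toℕ i + suc (k / n) * n                   ∎
          where
          open ≡-Reasoning
          regroup : ∀ r q s i → r + q + (s + i) ≡ i + (r + s + q)
          regroup = ℕSolver.solve-∀

        hit : cyclic p (k + g) ≡ true
        hit = begin
          cyclic p (k + g)                     ≡⟨ cong (cyclic p) k+g ⟩
          cyclic p (toℕ i + suc (k / n) * n)   ≡⟨ cyclic-+* p (toℕ i) (suc (k / n)) ⟩
          cyclic p (toℕ i)                     ≡⟨ cyclic-toℕ p i ⟩
          lookup p i                           ≡⟨ proj₂ inhabited ⟩
          true                                 ∎
          where open ≡-Reasoning

      -- At a member the distance is 0; elsewhere the gap is 0 and the first hit is one step further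
      -- from `k` than from `suc k`. This is the recurrence needed for telescoping.
      gap+distance : ∀ k → gap k + distance k ≡ suc (distance (suc k))
      gap+distance k with cyclic p k in eq
      ... | true  = trans (cong (suc (distance (suc k)) +_)
                             (IsFirst-unique (distance-isFirst k) (at-k , λ ())))
                          (+-identityʳ _)
        where
        at-k : cyclic p (k + 0) ≡ true
        at-k = trans (cong (cyclic p) (+-identityʳ k)) eq
      ... | false = IsFirst-unique (distance-isFirst k)
          (IsFirst-suc (trans (cong (cyclic p) (+-identityʳ k)) eq)
            (IsFirst-cong (λ l → cong (cyclic p) (sym (+-suc k l))) (distance-isFirst (suc k))))

      -- The gaps telescope, and the boundary terms `distance 0` and `distance n` agree by
      -- periodicity.
      sum-gaps : sum gaps ≡ n
      sum-gaps = +-cancelʳ-≡ (distance 0) (sum gaps) n (begin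
        sum gaps + distance 0  ≡⟨ sum-telescope gap distance gap+distance n ⟩
        n + distance n         ≡⟨ cong (n +_) (distance-cong {n} {0} ([m+n]%n≡m%n 0 n)) ⟩
        n + distance 0         ∎)
        where open ≡-Reasoning

      -- Members throw to the next member, and all other positions throw to themselves.
      cyclic-+gap : ∀ k → cyclic p (k + gap k) ≡ cyclic p k
      cyclic-+gap k with cyclic p k in eq
      ... | false = trans (cong (cyclic p) (+-identityʳ k)) eq
      ... | true  = trans (cong (cyclic p) (+-suc k (distance (suc k))))
                          (proj₁ (distance-isFirst (suc k)))

      between-gap : ∀ {I J} → cyclic p I ≡ true → I < J → J < I + gap I → cyclic p J ≡ false
      between-gap {I} {J} pI I<J J<I+gap with h , refl ← m≤n⇒∃[o]m+o≡n I<J =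
        proj₂ (distance-isFirst (suc I)) (+-cancelˡ-< (suc I) h _
          (subst (suc I + h <_) (trans (cong (λ m → I + m) (gap-true pI)) (+-suc I _)) J<I+gap))

      -- The factors suc c = 1 and suc c = 2 compare the ends and the midpoints of gaps.
      gap-separates-< : ∀ c {I J} → cyclic p I ≡ true → cyclic p J ≡ true → I < J →
                        suc c * I + gap I ≢ suc c * J + gap J
      gap-separates-< c {I} {J} pI pJ I<J eq =
        case trans (sym pJ) (between-gap pI I<J J<I+gap) of λ ()
        where
        open ≤-Reasoning
        J<I+gap : J < I + gap I
        -- Adding `c * I` brings `eq` into play: `I < J` bounds `c * I` by `c * J`, and positivity
        -- of `gap J` makes the chain strict. So `J` would be a member strictly inside the gap after
        -- `I`.
        J<I+gap = +-cancelʳ-< (c * I) J (I + gap I) (begin-strict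
          J + c * I          ≤⟨ +-monoʳ-≤ J (*-monoʳ-≤ c (<⇒≤ I<J)) ⟩
          suc c * J          <⟨ m<m+n (suc c * J) (subst (0 <_) (sym (gap-true pJ)) z<s) ⟩
          suc c * J + gap J  ≡⟨ eq ⟨
          suc c * I + gap I  ≡⟨ regroup I (c * I) (gap I) ⟩
          I + gap I + c * I  ∎)
          where
          regroup : ∀ x y z → x + y + z ≡ x + z + y
          regroup = ℕSolver.solve-∀

      gap-separates : ∀ c {I J} → cyclic p I ≡ true → cyclic p J ≡ true →
                      suc c * I + gap I ≡ suc c * J + gap J → I ≡ J
      gap-separates c {I} {J} pI pJ eq with <-cmp I J
      ... | tri< I<J _ _ = contradiction eq (gap-separates-< c pI pJ I<J)
      ... | tri≈ _ I≡J _ = I≡J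
      ... | tri> _ _ J<I = contradiction (sym eq) (gap-separates-< c pJ pI J<I)

      -- The gap function is periodic, so `gap-separates` applies to the lifts `toℕ i + a * n` and
      -- `toℕ j + b * n`; equal lifts have equal residues.
      gaps-separate : ∀ c {i j} a b → cyclic p (toℕ i) ≡ true → cyclic p (toℕ j) ≡ true →
                      suc c * (toℕ i + a * n) + lookup gaps i ≡ suc c * (toℕ j + b * n) + lookup gaps j →
                      i ≡ j
      gaps-separate c {i} {j} a b pi pj eq =
        toℕ+*-injective a b (gap-separates c
          (trans (cyclic-+* p (toℕ i) a) pi) (trans (cyclic-+* p (toℕ j) b) pj)
          (trans (cong (_ +_) (periodic i a)) (trans eq (cong (_ +_) (sym (periodic j b))))))
        where
        periodic : ∀ i a → gap (toℕ i + a * n) ≡ lookup gaps i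
        periodic i a = trans (gap-+* (toℕ i) a) (sym (lookup-gaps i))

      -- A throw preserves membership in `p`, so a common landing place determines it for both
      -- starting points.
      same-side : ∀ {i j} a b →
                  position i + lookup gaps i + a * n ≡ position j + lookup gaps j + b * n →
                  cyclic p (toℕ i) ≡ cyclic p (toℕ j)
      same-side {i} {j} a b eq =
        trans (sym (landing-side i a))
          (trans (cong (cyclic p) (suc-injective eq)) (landing-side j b))
        where
        landing-side : ∀ i a → cyclic p (toℕ i + lookup gaps i + a * n) ≡ cyclic p (toℕ i)
        landing-side i a = trans (cyclic-+* p (toℕ i + lookup gaps i) a)
          (trans (cong (λ x → cyclic p (toℕ i + x)) (lookup-gaps i)) (cyclic-+gap (toℕ i)))

      -- Colliding throws start on the same side of `p`. Two members are separated by the ends of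
      -- their gaps (`c = 0`); two nonmembers land where they stand.
      gaps-siteswap : IsSiteswap gaps
      gaps-siteswap {i} {j} eq
        with a , b , eq′ ← %≡⇒+*≡ (position i + lookup gaps i) (position j + lookup gaps j) eq
        with cyclic p (toℕ i) in pi
      ... | true  = gaps-separate 0 a b pi (trans (sym (same-side a b eq′)) pi)
          (trans (regroup (toℕ i) (a * n) (lookup gaps i))
            (trans (suc-injective eq′) (sym (regroup (toℕ j) (b * n) (lookup gaps j)))))
        where
        -- The `+ 0` comes from unfolding the factor `suc 0`.
        regroup : ∀ x y z → x + y + 0 + z ≡ x + z + y
        regroup = ℕSolver.solve-∀
      ... | false = toℕ+*-injective a b
          (trans (no-throw i a pi) (trans (suc-injective eq′)
            (sym (no-throw j b (trans (sym (same-side a b eq′)) pi)))))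
        where
        no-throw : ∀ i a → cyclic p (toℕ i) ≡ false →
                   toℕ i + a * n ≡ toℕ i + lookup gaps i + a * n
        no-throw i a pi rewrite lookup-gaps i | gap-false pi | +-identityʳ (toℕ i) = refl

-- Clearing denominators in the rational conditions

module _ {n : ℕ} .{{_ : NonZero n}} (t : Vec ℕ n) where

  oneBall⇒sum≡n : OneBall t → sum t ≡ n
  oneBall⇒sum≡n = clear n
    where
    -- The denominator is generalised apart from the length of `t`, so that it can be matched as a
    -- successor, the form in which `mkℚᵘ` stores it.
    clear : ∀ d .{{_ : NonZero d}} → ℤ.+ sum t ℚ./ d ≡ 1ℚ → sum t ≡ d
    clear (suc m) eq
      with *≡* eq′ ← ℚ./-injective-≃ (mkℚᵘ (ℤ.+ sum t) m) (mkℚᵘ (ℤ.+ 1) 0) eq =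
      ℤ.+-injective (trans (sym (ℤ.*-identityʳ _)) (trans eq′ (ℤ.*-identityˡ _)))

  sum≡n⇒oneBall : sum t ≡ n → OneBall t
  sum≡n⇒oneBall = unclear n
    where
    unclear : ∀ d .{{_ : NonZero d}} → sum t ≡ d → ℤ.+ sum t ℚ./ d ≡ 1ℚ
    unclear (suc m) eq =
      ℚ.fromℚᵘ-cong {mkℚᵘ (ℤ.+ sum t) m} {mkℚᵘ (ℤ.+ 1) 0}
        (*≡* (trans (ℤ.*-identityʳ _) (trans (cong ℤ.+_ eq) (sym (ℤ.*-identityˡ _)))))

-- Unnormalised rationals compute without gcd reduction, so the equation there is a plain
-- cross-multiplication. Subtracting two fractions over 2 gives denominator 4, hence twice the
-- desired equation, and a factor 2 is cancelled.
clear-halves : ∀ P s Q r k N →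
  ((P ℚ./ 1) ℚ.+ (s ℚ./ 2)) ℚ.- ((Q ℚ./ 1) ℚ.+ (r ℚ./ 2)) ≡ (k ℚ./ 1) ℚ.* (N ℚ./ 1) →
  (ℤ.+ 2 ℤ.* P ℤ.+ s) ℤ.- (ℤ.+ 2 ℤ.* Q ℤ.+ r) ≡ ℤ.+ 2 ℤ.* (k ℤ.* N)
clear-halves P s Q r k N eq =
  ℤ.*-cancelˡ-≡ (ℤ.+ 2) _ _ (trans (lhs P s Q r) (trans (ℚᵘ.drop-*≡* unnormalised) (rhs k N)))
  where
  half : ∀ x y → toℚᵘ ((x ℚ./ 1) ℚ.+ (y ℚ./ 2)) ≃ mkℚᵘ x 0 ℚᵘ.+ mkℚᵘ y 1
  half x y = ℚᵘ.≃-trans (ℚ.toℚᵘ-homo-+ (x ℚ./ 1) (y ℚ./ 2))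
    (ℚᵘ.+-cong (ℚ.toℚᵘ-fromℚᵘ (mkℚᵘ x 0)) (ℚ.toℚᵘ-fromℚᵘ (mkℚᵘ y 1)))

  unnormalised : (mkℚᵘ P 0 ℚᵘ.+ mkℚᵘ s 1) ℚᵘ.- (mkℚᵘ Q 0 ℚᵘ.+ mkℚᵘ r 1) ≃ mkℚᵘ k 0 ℚᵘ.* mkℚᵘ N 0
  unnormalised = begin
    (mkℚᵘ P 0 ℚᵘ.+ mkℚᵘ s 1) ℚᵘ.- (mkℚᵘ Q 0 ℚᵘ.+ mkℚᵘ r 1)
      ≈⟨ ℚᵘ.+-cong (half P s) (ℚᵘ.-‿cong (half Q r)) ⟨
    toℚᵘ p ℚᵘ.- toℚᵘ q                  ≈⟨ ℚᵘ.+-congʳ (toℚᵘ p) (ℚ.toℚᵘ-homo‿- q) ⟨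
    toℚᵘ p ℚᵘ.+ toℚᵘ (ℚ.- q)            ≈⟨ ℚ.toℚᵘ-homo-+ p (ℚ.- q) ⟨
    toℚᵘ (p ℚ.- q)                      ≈⟨ ℚ.toℚᵘ-cong eq ⟩
    toℚᵘ ((k ℚ./ 1) ℚ.* (N ℚ./ 1))      ≈⟨ ℚ.toℚᵘ-homo-* (k ℚ./ 1) (N ℚ./ 1) ⟩
    toℚᵘ (k ℚ./ 1) ℚᵘ.* toℚᵘ (N ℚ./ 1)  ≈⟨ ℚᵘ.*-cong (ℚ.toℚᵘ-fromℚᵘ (mkℚᵘ k 0)) (ℚ.toℚᵘ-fromℚᵘ (mkℚᵘ N 0)) ⟩
    mkℚᵘ k 0 ℚᵘ.* mkℚᵘ N 0              ∎
    where
    open import Relation.Binary.Reasoning.Setoid ℚᵘ.≃-setoid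
    p = (P ℚ./ 1) ℚ.+ (s ℚ./ 2)
    q = (Q ℚ./ 1) ℚ.+ (r ℚ./ 2)

  lhs : ∀ P s Q r →
    ℤ.+ 2 ℤ.* ((ℤ.+ 2 ℤ.* P ℤ.+ s) ℤ.- (ℤ.+ 2 ℤ.* Q ℤ.+ r)) ≡
    ((P ℤ.* ℤ.+ 2 ℤ.+ s ℤ.* ℤ.+ 1) ℤ.* ℤ.+ 2 ℤ.+ (ℤ.- (Q ℤ.* ℤ.+ 2 ℤ.+ r ℤ.* ℤ.+ 1)) ℤ.* ℤ.+ 2) ℤ.* ℤ.+ 1
  lhs = ℤSolver.solve-∀

  rhs : ∀ k N → (k ℤ.* N) ℤ.* ℤ.+ 4 ≡ ℤ.+ 2 ℤ.* (ℤ.+ 2 ℤ.* (k ℤ.* N))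
  rhs = ℤSolver.solve-∀

-- Writing the integer `k` as `b - a` and moving `a` to the other side yields an equation between
-- natural numbers, in the shape that `gaps-separate` consumes.
≡[mod]⇒+*≡ : ∀ x y s r n k →
  (ℤ.+ 2 ℤ.* ℤ.+ x ℤ.+ ℤ.+ s) ℤ.- (ℤ.+ 2 ℤ.* ℤ.+ y ℤ.+ ℤ.+ r) ≡ ℤ.+ 2 ℤ.* (k ℤ.* ℤ.+ n) →
  ∃[ a ] ∃[ b ] 2 * (x + a * n) + s ≡ 2 * (y + b * n) + r
≡[mod]⇒+*≡ x y s r n k eq = case k-split k of λ { (a , b , refl) →
  a , b , ℤ.+-injective (begin
    ℤ.+ (2 * (x + a * n) + s)
      ≡⟨ cast x a s ⟩
    ℤ.+ 2 ℤ.* (ℤ.+ x ℤ.+ ℤ.+ a ℤ.* ℤ.+ n) ℤ.+ ℤ.+ s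
      ≡⟨ split (ℤ.+ x) (ℤ.+ y) (ℤ.+ s) (ℤ.+ r) (ℤ.+ a) (ℤ.+ n) ⟩
    ((ℤ.+ 2 ℤ.* ℤ.+ x ℤ.+ ℤ.+ s) ℤ.- (ℤ.+ 2 ℤ.* ℤ.+ y ℤ.+ ℤ.+ r)) ℤ.+ (ℤ.+ 2 ℤ.* (ℤ.+ y ℤ.+ ℤ.+ a ℤ.* ℤ.+ n) ℤ.+ ℤ.+ r)
      ≡⟨ cong (ℤ._+ _) eq ⟩
    ℤ.+ 2 ℤ.* ((ℤ.+ b ℤ.- ℤ.+ a) ℤ.* ℤ.+ n) ℤ.+ (ℤ.+ 2 ℤ.* (ℤ.+ y ℤ.+ ℤ.+ a ℤ.* ℤ.+ n) ℤ.+ ℤ.+ r)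
      ≡⟨ join (ℤ.+ y) (ℤ.+ r) (ℤ.+ a) (ℤ.+ b) (ℤ.+ n) ⟩
    ℤ.+ 2 ℤ.* (ℤ.+ y ℤ.+ ℤ.+ b ℤ.* ℤ.+ n) ℤ.+ ℤ.+ r
      ≡⟨ cast y b r ⟨
    ℤ.+ (2 * (y + b * n) + r)
      ∎) }
  where
  open ≡-Reasoning

  k-split : ∀ k → ∃[ a ] ∃[ b ] k ≡ ℤ.+ b ℤ.- ℤ.+ a
  k-split (ℤ.+ m)  = 0 , m , sym (ℤ.+-identityʳ (ℤ.+ m))
  k-split -[1+ m ] = suc m , 0 , refl

  cast : ∀ x a s → ℤ.+ (2 * (x + a * n) + s) ≡ ℤ.+ 2 ℤ.* (ℤ.+ x ℤ.+ ℤ.+ a ℤ.* ℤ.+ n) ℤ.+ ℤ.+ s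
  cast x a s = trans (ℤ.pos-+ (2 * (x + a * n)) s) (cong (ℤ._+ ℤ.+ s)
    (trans (ℤ.pos-* 2 (x + a * n)) (cong (ℤ.+ 2 ℤ.*_)
      (trans (ℤ.pos-+ x (a * n)) (cong (λ z → ℤ.+ x ℤ.+ z) (ℤ.pos-* a n))))))

  split : ∀ x y s r a n → ℤ.+ 2 ℤ.* (x ℤ.+ a ℤ.* n) ℤ.+ s ≡
    ((ℤ.+ 2 ℤ.* x ℤ.+ s) ℤ.- (ℤ.+ 2 ℤ.* y ℤ.+ r)) ℤ.+ (ℤ.+ 2 ℤ.* (y ℤ.+ a ℤ.* n) ℤ.+ r)
  split = ℤSolver.solve-∀

  join : ∀ y r a b n →
    ℤ.+ 2 ℤ.* ((b ℤ.- a) ℤ.* n) ℤ.+ (ℤ.+ 2 ℤ.* (y ℤ.+ a ℤ.* n) ℤ.+ r) ≡ ℤ.+ 2 ℤ.* (y ℤ.+ b ℤ.* n) ℤ.+ r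
  join = ℤSolver.solve-∀

-- One-ball siteswaps are the gap sequences of their supports

positive : ℕ → Bool
positive zero    = false
positive (suc _) = true

support : ∀ {n} → Vec ℕ n → Vec Bool n
support = Vec.map positive

sum-support-∅ : ∀ {n} (t : Vec ℕ n) → support t ≡ replicate n false → sum t ≡ 0
sum-support-∅ []       _  = refl
sum-support-∅ (zero ∷ t) eq = sum-support-∅ t (∷-injectiveʳ eq)

module _ {n : ℕ} .{{_ : NonZero n}} where

  -- Doubled midpoints have the form `2 * I + gap I`, so this is the case `c = 1` of
  -- `gaps-separate`; a nonzero throw certifies membership in `p`.
  gaps-distinctMidpoints : ∀ p → (∃[ i ] lookup p i ≡ true) → DistinctMidpoints (gaps {n} p)
  gaps-distinctMidpoints p inhabited {i} {j} tᵢ≢0 tⱼ≢0 (k , eq) =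
    let
      t = gaps p
      a , b , eq′ = ≡[mod]⇒+*≡ (position i) (position j) (lookup t i) (lookup t j) n k
        (clear-halves (ℤ.+ position i) (ℤ.+ lookup t i) (ℤ.+ position j) (ℤ.+ lookup t j) k (ℤ.+ n) eq)
    in
    gaps-separate p inhabited 1 a b (gaps≢0⇒true p i tᵢ≢0) (gaps≢0⇒true p j tⱼ≢0)
      -- Positions count from 1 but `toℕ` from 0; after doubling, the offset is 2 on each side.
      (+-cancelˡ-≡ 2 _ _ (trans (pull (toℕ i + a * n) (lookup t i)) (trans eq′ (sym (pull (toℕ j + b * n) (lookup t j))))))
    where
    pull : ∀ x s → 2 + (2 * x + s) ≡ 2 * suc x + s
    pull = ℕSolver.solve-∀

  -- A gap is a successor at members and 0 elsewhere, whatever the distance is. As a left inverse of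
  -- `gaps`, `support` makes different subsets give different sequences.
  support-gaps : ∀ p → support (gaps {n} p) ≡ p
  support-gaps p = begin
    support (gaps p)                      ≡⟨ tabulate∘lookup (support (gaps p)) ⟨
    tabulate (lookup (support (gaps p)))  ≡⟨ tabulate-cong pointwise ⟩
    tabulate (lookup p)                   ≡⟨ tabulate∘lookup p ⟩
    p                                     ∎
    where
    open ≡-Reasoning
    positive-gap : ∀ k → positive (gap p k) ≡ cyclic p k
    positive-gap k with cyclic p k
    ... | true  = refl
    ... | false = refl

    pointwise : ∀ i → lookup (support (gaps p)) i ≡ lookup p i
    pointwise i = begin
      lookup (support (gaps p)) i    ≡⟨ lookup-map i positive (gaps p) ⟩
      positive (lookup (gaps p) i)   ≡⟨ cong positive (lookup-gaps p i) ⟩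
      positive (gap p (toℕ i))       ≡⟨ positive-gap (toℕ i) ⟩
      cyclic p (toℕ i)               ≡⟨ cyclic-toℕ p i ⟩
      lookup p i                     ∎

  gaps-injective : ∀ {p q} → gaps {n} p ≡ gaps q → p ≡ q
  gaps-injective {p} {q} eq =
    trans (sym (support-gaps p)) (trans (cong support eq) (support-gaps q))

  module _ (t : Vec ℕ n) (siteswap : IsSiteswap t) where

    -- Otherwise that position would throw to itself and collide with i.
    throws-into-support : ∀ i → lookup t i ≢ 0 → cyclic t (toℕ i + lookup t i) ≢ 0
    throws-into-support i tᵢ≢0 tⱼ≡0 = tᵢ≢0 (subst (λ j → lookup t j ≡ 0) (siteswap collision) tⱼ≡0)
      where
      open ≡-Reasoning
      x = toℕ i + lookup t i
      j = x mod n
      collision : landing t j ≡ landing t i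
      collision = begin
        (suc (toℕ j) + lookup t j) % n  ≡⟨ cong₂ (λ y z → (suc y + z) % n) (toℕ-mod x) tⱼ≡0 ⟩
        (suc (x % n) + 0) % n           ≡⟨ cong (_% n) (+-comm (suc (x % n)) 0) ⟩
        suc (x % n) % n                 ≡⟨ cong (_% n) (+-comm 1 (x % n)) ⟩
        (x % n + 1) % n                 ≡⟨ %-congˡ-+ 1 (m%n%n≡m%n x n) ⟩
        (x + 1) % n                     ≡⟨ cong (_% n) (+-comm x 1) ⟩
        suc x % n                       ∎

    -- A shorter nonzero throw would come down before the next support position, on an entry 0,
    -- against `throws-into-support`.
    gaps-support-≤ : (∃[ i ] lookup (support t) i ≡ true) →
                     ∀ i → lookup (gaps (support t)) i ≤ lookup t i
    gaps-support-≤ inhabited i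
      rewrite lookup-gaps (support t) i
      with cyclic (support t) (toℕ i) in pi
    ... | false = z≤n
    ... | true  = ≮⇒≥ too-short
      where
      d = distance (support t) (suc (toℕ i))

      cyclic-support : ∀ k → cyclic (support t) k ≡ positive (cyclic t k)
      cyclic-support k = lookup-map (k mod n) positive t

      positive⇒≢0 : ∀ {m} → positive m ≡ true → m ≢ 0
      positive⇒≢0 () refl

      ¬positive⇒≡0 : ∀ {m} → positive m ≡ false → m ≡ 0
      ¬positive⇒≡0 {zero} _ = refl

      tᵢ≢0 : lookup t i ≢ 0
      tᵢ≢0 = subst (_≢ 0) (cyclic-toℕ t i)
        (positive⇒≢0 (trans (sym (cyclic-support (toℕ i))) pi))

      too-short : ¬ (lookup t i < suc d)
      too-short tᵢ<1+d with lookup t i in tᵢ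
      ... | zero  = tᵢ≢0 tᵢ
      -- Here `m < d`, so `suc (toℕ i) + m` precedes the first support position found from
      -- `suc (toℕ i)`.
      ... | suc m = throws-into-support i tᵢ≢0 (begin
        cyclic t (toℕ i + lookup t i)  ≡⟨ cong (λ y → cyclic t (toℕ i + y)) tᵢ ⟩
        cyclic t (toℕ i + suc m)       ≡⟨ cong (cyclic t) (+-suc (toℕ i) m) ⟩
        cyclic t (suc (toℕ i) + m)     ≡⟨ ¬positive⇒≡0 (trans (sym (cyclic-support _))
                                           (proj₂ (distance-isFirst (support t) inhabited (suc (toℕ i))) (s≤s⁻¹ tᵢ<1+d))) ⟩
        0                              ∎)
        where open ≡-Reasoning

    -- An empty support would force the sum to be 0 instead of `n`.
    oneBall-siteswap-support : OneBall t → support t ∈ nonemptySubsets n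
    oneBall-siteswap-support ball with ∈-nonemptySubsets (support t)
    ... | inj₂ p∈  = p∈
    ... | inj₁ p≡∅ =
      contradiction (trans (sym (oneBall⇒sum≡n t ball)) (sum-support-∅ t p≡∅)) (≢-nonZero⁻¹ n)

    gaps-support : OneBall t → gaps (support t) ≡ t
    gaps-support ball = ≤∧sum≡⇒≡ (gaps (support t)) t (gaps-support-≤ inhabited)
      (trans (sum-gaps (support t) inhabited) (sym (oneBall⇒sum≡n t ball)))
      where inhabited = nonemptySubsets-inhabited (oneBall-siteswap-support ball)

  -- `P` is squeezed between being the gap sequence of a nonempty subset and being a one-ball
  -- siteswap. These extremes coincide, so one list serves both the plain and the spherical count.
  hasCount : {P : Vec ℕ n → Set} →
             (∀ {t} → P t → IsSiteswap t × OneBall t) →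
             (∀ {p} → (∃[ i ] lookup p i ≡ true) → P (gaps p)) →
             HasCount P (2 ^ n ∸ 1)
  hasCount {P} P⇒ gaps⇒P =
      List.map gaps (nonemptySubsets n)
    , Unique.map⁺ gaps-injective (nonemptySubsets-unique n)
    , (λ t → mk⇔ to from)
    , trans (length-map gaps (nonemptySubsets n)) (cong (_∸ 1) (1+length-nonemptySubsets n))
    where
    to : ∀ {t} → t ∈ List.map gaps (nonemptySubsets n) → P t
    to t∈ with p , p∈ , refl ← ∈-map⁻ gaps t∈ = gaps⇒P {p} (nonemptySubsets-inhabited p∈)

    from : ∀ {t} → P t → t ∈ List.map gaps (nonemptySubsets n)
    from {t} Pt with siteswap , ball ← P⇒ Pt =
      subst (_∈ _) (gaps-support t siteswap ball)
        (∈-map⁺ gaps (oneBall-siteswap-support t siteswap ball))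

mainTheorem3 : (n : ℕ) .{{_ : NonZero n}} →
    HasCount (λ (t : Vec ℕ n) → IsSiteswap t × OneBall t) (2 ^ n ∸ 1)
    × HasCount (λ (t : Vec ℕ n) → IsSphericalSiteswap t × OneBall t) (2 ^ n ∸ 1)
mainTheorem3 n =
    hasCount {P = λ t → IsSiteswap t × OneBall t} (λ t-ok → t-ok) (λ {p} inh → gaps-siteswap p inh , one-ball p inh)
  , hasCount {P = λ t → IsSphericalSiteswap t × OneBall t}
             (λ ((siteswap , _) , ball) → siteswap , ball)
             (λ {p} inh → (gaps-siteswap p inh , gaps-distinctMidpoints p inh) , one-ball p inh)
  where
  one-ball : ∀ p → (∃[ i ] lookup p i ≡ true) → OneBall (gaps {n} p)
  one-ball p inh = sum≡n⇒oneBall (gaps p) (sum-gaps p inh)
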